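{- Let $a,b$ be integers with $a>b\geq 1$, and set $q=2^{b+1}-1$ and $p=2^{a+1}-(2^b+1)$. Then $n=pq\,2^a$ is strongly pseudoperfect. Moreover, if $p$ and $q$ are prime, then $n$ is strongly pseudoperfect with exactly four omitted divisors, i.e. $n$ has a strongly pseudoperfect representation with exactly four omitted divisors.
   Context: A positive integer $n$ is strongly pseudoperfect if there is a subset $S$ of the positive divisors of $n$ (with $1$ and $n$ themselves allowed) such that $d\in S$ if and only if $n/d\in S$ for every positive divisor $d$ of $n$, and $\sum_{d\in S} d = 2n$. Such a set $S$ is called a strongly pseudoperfect representation of $n$. A positive divisor of $n$ that is not in $S$ is called an omitted divisor of the representation. -}

module Defs where

open import Data.List.Base using (List; filter; length; upTo)
open import Data.List.Membership.Propositional using (_∈_)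
open import Data.List.Relation.Unary.All using (All)
open import Data.List.Relation.Unary.Unique.Propositional using (Unique)
open import Data.Nat.Base using (ℕ; suc; _*_; _>_)
open import Data.Nat.Divisibility using (_∣_; _∣?_; quotient)
open import Data.Nat.ListAction using (sum)
open import Data.Nat.Properties using (_≟_)
open import Data.Product using (∃; _×_)
open import Function.Bundles using (_⇔_)
open import Relation.Binary.PropositionalEquality using (_≡_)
open import Data.List.Membership.DecPropositional _≟_ using (_∉?_)

divisors : ℕ → List ℕ
divisors n = filter (_∣? n) (upTo (suc n))

-- A finite set of divisors is a duplicate-free list, so `sum S` is the sum
-- over the set.
record IsRepresentation (n : ℕ) (S : List ℕ) : Set where
  field
    positive  : n > 0
    unique    : Unique S
    divide    : All (_∣ n) S
    -- For d ∣ n with n > 0, `quotient d∣n` is n / d.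
    symmetric : ∀ {d} (d∣n : d ∣ n) → d ∈ S ⇔ quotient d∣n ∈ S
    sum≡2n    : sum S ≡ 2 * n

StronglyPseudoperfect : ℕ → Set
StronglyPseudoperfect n = ∃ λ S → IsRepresentation n S

omitted : ℕ → List ℕ → List ℕ
omitted n S = filter (_∉? S) (divisors n)

StronglyPseudoperfectOmitting : ℕ → ℕ → Set
StronglyPseudoperfectOmitting k n =
  ∃ λ S → IsRepresentation n S × length (omitted n S) ≡ k

-- Let k = a − b and let F be the list of the divisors x 2^i of n with x ∈ {1, q, p, pq} and i ≤ a.
-- The sum of F exceeds 2n by p (p + 2^b + 1) + 2 · 4^b, and this excess is exactly the sum of the
-- two complementary pairs {2^b, pq 2^k} and {p 2^k, q 2^b}.  Removing these four divisors from F
-- leaves the representation, and when p and q are prime F contains every divisor of n.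

module Submission where

open import Data.Bool.Base using (Bool; true; false; not)
open import Data.List.Base
  using (List; []; _∷_; _++_; _∷ʳ_; [_]; map; filter; upTo; cartesianProductWith)
open import Data.List.Properties using (map-++; upTo-∷ʳ)
open import Data.List.Membership.Propositional using (_∈_; _∉_)
open import Data.List.Membership.Propositional.Properties
  using (∈-filter⁺; ∈-filter⁻; ∈-++⁺ˡ; ∈-++⁺ʳ; ∈-++⁻; ∈-upTo⁺; ∈-upTo⁻
        ; ∈-cartesianProductWith⁺; ∈-cartesianProductWith⁻)
open import Data.List.Membership.Propositional.Properties.WithK using (unique∧set⇒bag)
open import Data.List.Relation.Binary.BagAndSetEquality using (∼bag⇒↭)
open import Data.List.Relation.Binary.Permutation.Propositional using (_↭_)
open import Data.List.Relation.Binary.Permutation.Propositional.Properties using (↭-length)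
open import Data.List.Relation.Binary.Subset.Propositional using (_⊆_)
open import Data.List.Relation.Unary.All as All using ([]; _∷_)
open import Data.List.Relation.Unary.AllPairs using ([]; _∷_)
open import Data.List.Relation.Unary.Any using (here; there)
open import Data.List.Relation.Unary.Unique.Propositional using (Unique)
import Data.List.Relation.Unary.Unique.Propositional.Properties as Unique
open import Data.Nat.Base
  using (ℕ; zero; suc; _+_; _*_; _∸_; _^_; _≤_; _<_; _>_; _≥_; z≤n; s≤s; s≤s⁻¹; NonZero
        ; >-nonZero; >-nonZero⁻¹; ≢-nonZero)
open import Data.Nat.Divisibility
open import Data.Nat.ListAction using (sum)
open import Data.Nat.ListAction.Properties using (sum-++; sum-↭)
open import Data.Nat.Primality using (Prime; prime[2]; euclidsLemma; prime⇒nonZero; prime⇒irreducible)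
open import Data.Nat.Coprimality using (coprime-divisor)
open import Data.Nat.Properties
open import Data.Nat.Tactic.RingSolver using (solve-∀)
open import Data.Product using (∃-syntax; _×_; _,_; proj₁; proj₂; uncurry)
open import Data.Sum using (_⊎_; inj₁; inj₂; [_,_]′)
open import Function.Base using (_∘_)
open import Function.Bundles using (mk⇔)
open import Relation.Binary.PropositionalEquality
  using (_≡_; refl; sym; trans; cong; cong₂; subst; module ≡-Reasoning)
open import Relation.Nullary using (yes; no; contradiction)
open import Data.List.Membership.DecPropositional _≟_ using (_∈?_; _∉?_)
open import Defs

-- Duplicate-free lists as finite sets.

-- Membership in a duplicate-free list has at most one proof, so mutual inclusion is already a
-- bijection of membership proofs.
Unique-⊆⊇⇒↭ : ∀ {ℓ} {A : Set ℓ} {xs ys : List A} →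
              Unique xs → Unique ys → xs ⊆ ys → ys ⊆ xs → xs ↭ ys
Unique-⊆⊇⇒↭ xs! ys! xs⊆ys ys⊆xs = ∼bag⇒↭ (unique∧set⇒bag xs! ys! (mk⇔ xs⊆ys ys⊆xs))

-- Gives the sum over a set difference by cancelling `sum ys` from an equation, with no subtraction.
filter-∉-++-↭ : ∀ {xs ys} → Unique xs → Unique ys → ys ⊆ xs → filter (_∉? ys) xs ++ ys ↭ xs
filter-∉-++-↭ {xs} {ys} xs! ys! ys⊆xs = Unique-⊆⊇⇒↭
  (Unique.++⁺ (Unique.filter⁺ (_∉? ys) xs!) ys!
    λ (v∈ , v∈ys) → proj₂ (∈-filter⁻ (_∉? ys) {xs = xs} v∈) v∈ys)
  xs!
  (λ v∈ → [ (λ v∈ˡ → proj₁ (∈-filter⁻ (_∉? ys) {xs = xs} v∈ˡ)) , ys⊆xs ]′ (∈-++⁻ _ v∈))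
  split
  where
  split : xs ⊆ filter (_∉? ys) xs ++ ys
  split {v} v∈xs with v ∈? ys
  ... | yes v∈ys = ∈-++⁺ʳ _ v∈ys
  ... | no  v∉ys = ∈-++⁺ˡ (∈-filter⁺ (_∉? ys) v∈xs v∉ys)

-- Sums of products and of powers of 2.

sum-map-*ˡ : ∀ {A : Set} (g : A → ℕ) c xs → sum (map (λ x → c * g x) xs) ≡ c * sum (map g xs)
sum-map-*ˡ g c []       = sym (*-zeroʳ c)
sum-map-*ˡ g c (x ∷ xs) =
  trans (cong (c * g x +_) (sum-map-*ˡ g c xs)) (sym (*-distribˡ-+ c (g x) (sum (map g xs))))

sum-cartesianProductWith-* : ∀ {A B : Set} (f : A → ℕ) (g : B → ℕ) xs ys →
  sum (cartesianProductWith (λ x y → f x * g y) xs ys) ≡ sum (map f xs) * sum (map g ys)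
sum-cartesianProductWith-* f g []       ys = refl
sum-cartesianProductWith-* f g (x ∷ xs) ys = begin
  sum (map (λ y → f x * g y) ys ++ cartesianProductWith _ xs ys)
    ≡⟨ sum-++ (map (λ y → f x * g y) ys) _ ⟩
  sum (map (λ y → f x * g y) ys) + sum (cartesianProductWith _ xs ys)
    ≡⟨ cong₂ _+_ (sum-map-*ˡ g (f x) ys) (sum-cartesianProductWith-* f g xs ys) ⟩
  f x * sum (map g ys) + sum (map f xs) * sum (map g ys)
    ≡⟨ *-distribʳ-+ (sum (map g ys)) (f x) (sum (map f xs)) ⟨
  (f x + sum (map f xs)) * sum (map g ys) ∎
  where open ≡-Reasoning

suc-sum-powers-of-2 : ∀ m → suc (sum (map (2 ^_) (upTo m))) ≡ 2 ^ m
suc-sum-powers-of-2 zero    = refl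
suc-sum-powers-of-2 (suc m) = begin
  -- `upTo` unfolds at the front, but the induction hypothesis needs the largest power split off at
  -- the end.
  suc (sum (map (2 ^_) (upTo (suc m))))        ≡⟨ cong (suc ∘ sum ∘ map (2 ^_)) (upTo-∷ʳ m) ⟨
  suc (sum (map (2 ^_) (upTo m ∷ʳ m)))         ≡⟨ cong (suc ∘ sum) (map-++ (2 ^_) (upTo m) [ m ]) ⟩
  suc (sum (map (2 ^_) (upTo m) ∷ʳ 2 ^ m))     ≡⟨ cong suc (sum-++ (map (2 ^_) (upTo m)) [ 2 ^ m ]) ⟩
  -- The `+ 0` left by the singleton sum is also what `2 * 2 ^ m` unfolds to, so the last line holds
  -- by computation.
  suc (sum (map (2 ^_) (upTo m))) + (2 ^ m + 0) ≡⟨ cong (_+ (2 ^ m + 0)) (suc-sum-powers-of-2 m) ⟩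
  2 ^ suc m                                    ∎
  where open ≡-Reasoning

-- Parity, and divisors of a product with a prime factor.

∣suc⇒∣1 : ∀ {d m} → d ∣ m → d ∣ suc m → d ∣ 1
∣suc⇒∣1 {d} {m} d∣m d∣1+m = ∣m+n∣m⇒∣n (subst (d ∣_) (+-comm 1 m) d∣1+m) d∣m

2∤1 : 2 ∤ 1
2∤1 = >⇒∤ (s≤s (s≤s z≤n))

2∣c*2^[1+i] : ∀ c i → 2 ∣ c * 2 ^ suc i
2∣c*2^[1+i] c i = ∣n⇒∣m*n c (m∣m*n (2 ^ i))

-- Cancel 2 from both sides until one exponent is 0; if the other is still positive, 2 divides an
-- odd number.
odd*2^-injective : ∀ {c d} → 2 ∤ c → 2 ∤ d → ∀ i j → c * 2 ^ i ≡ d * 2 ^ j → c ≡ d × i ≡ j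
odd*2^-injective {c} {d} c-odd d-odd = go
  where
  pull-2 : ∀ x y → x * (2 * y) ≡ 2 * (x * y)
  pull-2 = solve-∀

  go : ∀ i j → c * 2 ^ i ≡ d * 2 ^ j → c ≡ d × i ≡ j
  go zero    zero    eq = trans (sym (*-identityʳ c)) (trans eq (*-identityʳ d)) , refl
  go zero    (suc j) eq = contradiction
    (subst (2 ∣_) (trans (sym eq) (*-identityʳ c)) (2∣c*2^[1+i] d j)) c-odd
  go (suc i) zero    eq = contradiction
    (subst (2 ∣_) (trans eq (*-identityʳ d)) (2∣c*2^[1+i] c i)) d-odd
  go (suc i) (suc j) eq
    with c≡d , i≡j ← go i j (*-cancelˡ-≡ _ _ 2
           (trans (sym (pull-2 c (2 ^ i))) (trans eq (pull-2 d (2 ^ j)))))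
    = c≡d , cong suc i≡j

-- If `r` does not divide `d`, the two are coprime because `r` has only the divisors 1 and `r`;
-- otherwise `r` cancels. Used to strip p, q and the powers of 2 from a divisor of n.
∣prime*⇒ : ∀ {r d m} → Prime r → d ∣ r * m → d ∣ m ⊎ ∃[ e ] (d ≡ r * e × e ∣ m)
∣prime*⇒ {r} {d} {m} r-prime d∣rm with r ∣? d
... | yes (divides e refl) =
      inj₂ (e , *-comm e r , *-cancelˡ-∣ r ⦃ prime⇒nonZero r-prime ⦄ (subst (_∣ r * m) (*-comm e r) d∣rm))
... | no  r∤d = inj₁ (coprime-divisor coprime d∣rm)
  where
  coprime : ∀ {g} → g ∣ d × g ∣ r → g ≡ 1
  coprime (g∣d , g∣r) with prime⇒irreducible r-prime g∣r
  ... | inj₁ g≡1  = g≡1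
  ... | inj₂ refl = contradiction g∣d r∤d

∣2^⇒≡2^ : ∀ m {d} → d ∣ 2 ^ m → ∃[ i ] (i ≤ m × d ≡ 2 ^ i)
∣2^⇒≡2^ zero    d∣1 = 0 , z≤n , ∣1⇒≡1 d∣1
∣2^⇒≡2^ (suc m) d∣2^[1+m] with ∣prime*⇒ prime[2] d∣2^[1+m]
... | inj₁ d∣2^m with i , i≤m , d≡2^i ← ∣2^⇒≡2^ m d∣2^m = i , m≤n⇒m≤1+n i≤m , d≡2^i
... | inj₂ (e , d≡2e , e∣2^m) with i , i≤m , e≡2^i ← ∣2^⇒≡2^ m e∣2^m =
      suc i , s≤s i≤m , trans d≡2e (cong (2 *_) e≡2^i)

-- The numbers p, q and n.

-- With `k` for a - b and with p and q given by additive equations, the sum computation becomes a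
-- chain of semiring identities.
module Family
  (a b k p q : ℕ) (b+k≡a : b + k ≡ a) (1≤b : 1 ≤ b) (1≤k : 1 ≤ k)
  (1+q≡2^[1+b] : suc q ≡ 2 * 2 ^ b) (p+1+2^b≡2^[1+a] : p + suc (2 ^ b) ≡ 2 * 2 ^ a)
  where

  n : ℕ
  n = p * q * 2 ^ a

  2^a≡2^b*2^k : 2 ^ a ≡ 2 ^ b * 2 ^ k
  2^a≡2^b*2^k = trans (cong (2 ^_) (sym b+k≡a)) (^-distribˡ-+-* 2 b k)

  k+b≡a : k + b ≡ a
  k+b≡a = trans (+-comm k b) b+k≡a

  1<q : 1 < q
  1<q = s≤s⁻¹ (begin
    3         ≤⟨ n≤1+n 3 ⟩
    2 * 2 ^ 1 ≤⟨ *-monoʳ-≤ 2 (^-monoʳ-≤ 2 1≤b) ⟩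
    2 * 2 ^ b ≡⟨ 1+q≡2^[1+b] ⟨
    suc q     ∎)
    where open ≤-Reasoning

  -- Both q + 1 and 2^b + 1 are at most 2^(b+1), and twice that is 2^(b+2) ≤ 2^(a+1) because k ≥ 1.
  q<p : q < p
  q<p = +-cancelʳ-≤ (suc (2 ^ b)) (suc q) p (begin
    suc q + suc (2 ^ b)           ≤⟨ +-monoʳ-≤ (suc q) (+-monoˡ-≤ (2 ^ b) (m^n>0 2 b)) ⟩
    suc q + (2 ^ b + 2 ^ b)       ≡⟨ cong (_+ (2 ^ b + 2 ^ b)) 1+q≡2^[1+b] ⟩
    2 * 2 ^ b + (2 ^ b + 2 ^ b)   ≡⟨ four (2 ^ b) ⟩
    2 * (2 ^ b * 2 ^ 1)           ≤⟨ *-monoʳ-≤ 2 (*-monoʳ-≤ (2 ^ b) (^-monoʳ-≤ 2 1≤k)) ⟩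
    2 * (2 ^ b * 2 ^ k)           ≡⟨ cong (2 *_) 2^a≡2^b*2^k ⟨
    2 * 2 ^ a                     ≡⟨ p+1+2^b≡2^[1+a] ⟨
    p + suc (2 ^ b)               ∎)
    where
    open ≤-Reasoning
    four : ∀ x → 2 * x + (x + x) ≡ 2 * (x * 2)
    four = solve-∀

  1<p : 1 < p
  1<p = <-trans 1<q q<p

  p<p*q : p < p * q
  p<p*q = m<m*n p q ⦃ >-nonZero (<-trans (s≤s z≤n) 1<p) ⦄ 1<q

  q-odd : 2 ∤ q
  q-odd 2∣q = 2∤1 (∣suc⇒∣1 2∣q (subst (2 ∣_) (sym 1+q≡2^[1+b]) (m∣m*n (2 ^ b))))

  -- If p were even, 2^b + 1 = 2^(a+1) - p would be even too, while b ≥ 1 makes 2^b even.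
  p-odd : 2 ∤ p
  p-odd 2∣p = 2∤1 (∣suc⇒∣1 2∣2^b
    (∣m+n∣m⇒∣n (subst (2 ∣_) (sym p+1+2^b≡2^[1+a]) (m∣m*n (2 ^ a))) 2∣p))
    where
    2∣2^b : 2 ∣ 2 ^ b
    2∣2^b = subst (λ m → 2 ∣ 2 ^ m) (m+[n∸m]≡n 1≤b) (m∣m*n (2 ^ (b ∸ 1)))

  p*q-odd : 2 ∤ p * q
  p*q-odd 2∣pq = [ p-odd , q-odd ]′ (euclidsLemma p q prime[2] 2∣pq)

  -- (s , t) stands for the divisor p^s q^t of pq.
  Exponents : Set
  Exponents = Bool × Bool

  oddPart : Exponents → ℕ
  oddPart (false , false) = 1
  oddPart (false , true ) = q
  oddPart (true  , false) = p
  oddPart (true  , true ) = p * q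

  complement : Exponents → Exponents
  complement (s , t) = not s , not t

  oddPart-complement : ∀ x → oddPart (complement x) * oddPart x ≡ p * q
  oddPart-complement (false , false) = *-identityʳ (p * q)
  oddPart-complement (false , true ) = refl
  oddPart-complement (true  , false) = *-comm q p
  oddPart-complement (true  , true ) = *-identityˡ (p * q)

  oddPart-odd : ∀ x → 2 ∤ oddPart x
  oddPart-odd (false , false) = 2∤1
  oddPart-odd (false , true ) = q-odd
  oddPart-odd (true  , false) = p-odd
  oddPart-odd (true  , true ) = p*q-odd

  -- The chain 1 < q < p < pq separates the four values.
  oddPart-injective : ∀ x y → oddPart x ≡ oddPart y → x ≡ y
  oddPart-injective (false , false) (false , false) _  = refl
  oddPart-injective (false , false) (false , true ) eq = contradiction eq (<⇒≢ 1<q)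
  oddPart-injective (false , false) (true  , false) eq = contradiction eq (<⇒≢ 1<p)
  oddPart-injective (false , false) (true  , true ) eq = contradiction eq (<⇒≢ (<-trans 1<p p<p*q))
  oddPart-injective (false , true ) (false , false) eq = contradiction eq (>⇒≢ 1<q)
  oddPart-injective (false , true ) (false , true ) _  = refl
  oddPart-injective (false , true ) (true  , false) eq = contradiction eq (<⇒≢ q<p)
  oddPart-injective (false , true ) (true  , true ) eq = contradiction eq (<⇒≢ (<-trans q<p p<p*q))
  oddPart-injective (true  , false) (false , false) eq = contradiction eq (>⇒≢ 1<p)
  oddPart-injective (true  , false) (false , true ) eq = contradiction eq (>⇒≢ q<p)
  oddPart-injective (true  , false) (true  , false) _  = refl
  oddPart-injective (true  , false) (true  , true ) eq = contradiction eq (<⇒≢ p<p*q)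
  oddPart-injective (true  , true ) (false , false) eq = contradiction eq (>⇒≢ (<-trans 1<p p<p*q))
  oddPart-injective (true  , true ) (false , true ) eq = contradiction eq (>⇒≢ (<-trans q<p p<p*q))
  oddPart-injective (true  , true ) (true  , false) eq = contradiction eq (>⇒≢ p<p*q)
  oddPart-injective (true  , true ) (true  , true ) _  = refl

  divisor : Exponents → ℕ → ℕ
  divisor x i = oddPart x * 2 ^ i

  divisor-injective : ∀ {x y i j} → divisor x i ≡ divisor y j → x ≡ y × i ≡ j
  divisor-injective {x} {y} {i} {j} eq
    with x≡y , i≡j ← odd*2^-injective (oddPart-odd x) (oddPart-odd y) i j eq
    = oddPart-injective x y x≡y , i≡j

  -- Zero is even.
  oddPart≢0 : ∀ x → NonZero (oddPart x)
  oddPart≢0 x = ≢-nonZero λ x≡0 → oddPart-odd x (subst (2 ∣_) (sym x≡0) (2 ∣0))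

  divisor≢0 : ∀ x i → NonZero (divisor x i)
  divisor≢0 x i = m*n≢0 _ _ ⦃ oddPart≢0 x ⦄ ⦃ m^n≢0 2 i ⦄

  n≢0 : NonZero n
  n≢0 = divisor≢0 (true , true) a

  -- Tying `j` to `i` by an equation covers both the general cofactor exponent `a ∸ i` and the
  -- exponents `b` and `k` of the removed divisors.
  divisor-complement : ∀ x i j → j + i ≡ a → divisor (complement x) j * divisor x i ≡ n
  divisor-complement x i j j+i≡a = begin
    oddPart (complement x) * 2 ^ j * (oddPart x * 2 ^ i)
      ≡⟨ [m*n]*[o*p]≡[m*o]*[n*p] (oddPart (complement x)) (2 ^ j) (oddPart x) (2 ^ i) ⟩
    oddPart (complement x) * oddPart x * (2 ^ j * 2 ^ i)
      ≡⟨ cong₂ _*_ (oddPart-complement x) (trans (sym (^-distribˡ-+-* 2 j i)) (cong (2 ^_) j+i≡a)) ⟩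
    n ∎
    where open ≡-Reasoning

  complement-unique : ∀ x i j {e} → j + i ≡ a → e * divisor x i ≡ n → e ≡ divisor (complement x) j
  complement-unique x i j j+i≡a e*d≡n =
    *-cancelʳ-≡ _ _ (divisor x i) ⦃ divisor≢0 x i ⦄ (trans e*d≡n (sym (divisor-complement x i j j+i≡a)))

  -- The candidate divisors and the four removed ones.

  exponents : List Exponents
  exponents = (false , false) ∷ (false , true) ∷ (true , false) ∷ (true , true) ∷ []

  exponents-complete : ∀ x → x ∈ exponents
  exponents-complete (false , false) = here refl
  exponents-complete (false , true ) = there (here refl)
  exponents-complete (true  , false) = there (there (here refl))
  exponents-complete (true  , true ) = there (there (there (here refl)))

  exponents! : Unique exponents
  exponents! = ((λ ()) ∷ (λ ()) ∷ (λ ()) ∷ []) ∷ ((λ ()) ∷ (λ ()) ∷ []) ∷ ((λ ()) ∷ []) ∷ [] ∷ []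

  -- This is the list F.
  candidates : List ℕ
  candidates = cartesianProductWith divisor exponents (upTo (suc a))

  -- The first two entries are one complementary pair, the last two the other. Kept as indices, the
  -- entries differ already in their exponents of p and q, however `b` and `k` compare.
  removedIndices : List (Exponents × ℕ)
  removedIndices = ((false , false) , b) ∷ ((true , true) , k) ∷ ((true , false) , k) ∷ ((false , true) , b) ∷ []

  removed : List ℕ
  removed = map (uncurry divisor) removedIndices

  chosen : List ℕ
  chosen = filter (_∉? removed) candidates

  candidates! : Unique candidates
  candidates! = Unique.cartesianProductWith⁺ divisor
    (λ {x} {y} {i} {j} → divisor-injective {x} {y} {i} {j}) exponents! (Unique.upTo⁺ (suc a))

  removedIndices! : Unique removedIndices
  removedIndices! =
    ((λ ()) ∷ (λ ()) ∷ (λ ()) ∷ []) ∷ ((λ ()) ∷ (λ ()) ∷ []) ∷ ((λ ()) ∷ []) ∷ [] ∷ []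

  removed! : Unique removed
  removed! = Unique.map⁺ {f = uncurry divisor} injective removedIndices!
    where
    injective : ∀ {u v} → uncurry divisor u ≡ uncurry divisor v → u ≡ v
    injective {x , i} {y , j} eq with x≡y , i≡j ← divisor-injective {x} {y} {i} {j} eq = cong₂ _,_ x≡y i≡j

  ∈-candidates⁺ : ∀ x i → i ≤ a → divisor x i ∈ candidates
  ∈-candidates⁺ x i i≤a = ∈-cartesianProductWith⁺ divisor (exponents-complete x) (∈-upTo⁺ (s≤s i≤a))

  ∈-candidates⁻ : ∀ {d} → d ∈ candidates → ∃[ x ] ∃[ i ] (i ≤ a × d ≡ divisor x i)
  ∈-candidates⁻ d∈
    with x , i , _ , i∈ , d≡ ← ∈-cartesianProductWith⁻ divisor exponents (upTo (suc a)) d∈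
    = x , i , s≤s⁻¹ (∈-upTo⁻ i∈) , d≡

  removed⊆candidates : removed ⊆ candidates
  removed⊆candidates (here refl) =
    ∈-candidates⁺ (false , false) b (m+n≤o⇒n≤o k (≤-reflexive k+b≡a))
  removed⊆candidates (there (here refl)) =
    ∈-candidates⁺ (true , true) k (m+n≤o⇒n≤o b (≤-reflexive b+k≡a))
  removed⊆candidates (there (there (here refl))) =
    ∈-candidates⁺ (true , false) k (m+n≤o⇒n≤o b (≤-reflexive b+k≡a))
  removed⊆candidates (there (there (there (here refl)))) =
    ∈-candidates⁺ (false , true) b (m+n≤o⇒n≤o k (≤-reflexive k+b≡a))

  -- Closure under d ↦ n/d.

  candidates∣n : ∀ {d} → d ∈ candidates → d ∣ n
  candidates∣n d∈ with x , i , i≤a , refl ← ∈-candidates⁻ d∈ =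
    divides (divisor (complement x) (a ∸ i)) (sym (divisor-complement x i (a ∸ i) (m∸n+n≡m i≤a)))

  candidates-closed : ∀ {d e} → e * d ≡ n → d ∈ candidates → e ∈ candidates
  candidates-closed e*d≡n d∈ with x , i , i≤a , refl ← ∈-candidates⁻ d∈ =
    subst (_∈ candidates) (sym (complement-unique x i (a ∸ i) (m∸n+n≡m i≤a) e*d≡n))
      (∈-candidates⁺ (complement x) (a ∸ i) (m∸n≤m a i))

  -- As b + k = a, both 2^b · pq 2^k and p 2^k · q 2^b equal n; each case moves to the partner
  -- within its pair.
  removed-closed : ∀ {d e} → e * d ≡ n → d ∈ removed → e ∈ removed
  removed-closed eq (here refl) =
    there (here (complement-unique (false , false) b k k+b≡a eq))
  removed-closed eq (there (here refl)) =
    here (complement-unique (true , true) k b b+k≡a eq)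
  removed-closed eq (there (there (here refl))) =
    there (there (there (here (complement-unique (true , false) k b b+k≡a eq))))
  removed-closed eq (there (there (there (here refl)))) =
    there (there (here (complement-unique (false , true) b k k+b≡a eq)))

  ∈-chosen⁺ : ∀ {d} → d ∈ candidates → d ∉ removed → d ∈ chosen
  ∈-chosen⁺ = ∈-filter⁺ (_∉? removed)

  ∈-chosen⁻ : ∀ {d} → d ∈ chosen → d ∈ candidates × d ∉ removed
  ∈-chosen⁻ = ∈-filter⁻ (_∉? removed) {xs = candidates}

  -- If the cofactor `e` had been removed, its own cofactor `d` would have been removed as well.
  chosen-closed : ∀ {d e} → e * d ≡ n → d ∈ chosen → e ∈ chosen
  chosen-closed {d} {e} e*d≡n d∈ with d∈candidates , d∉removed ← ∈-chosen⁻ d∈ =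
    ∈-chosen⁺ (candidates-closed e*d≡n d∈candidates)
      (d∉removed ∘ removed-closed (trans (*-comm d e) e*d≡n))

  -- The sum of the divisors.

  sum-candidates : sum candidates ≡ 2 * n + sum removed
  sum-candidates = begin
    sum candidates
      ≡⟨ sum-cartesianProductWith-* oddPart (2 ^_) exponents (upTo (suc a)) ⟩
    sum (map oddPart exponents) * sum (map (2 ^_) (upTo (suc a)))
      ≡⟨ cong (sum (map oddPart exponents) *_) powers ⟩
    (1 + (q + (p + (p * q + 0)))) * (p + B)
      ≡⟨ factor p q B ⟩
    suc q * (suc p * (p + B))
      ≡⟨ cong (_* (suc p * (p + B))) 1+q≡2^[1+b] ⟩
    2 * B * (suc p * (p + B))
      -- (p + 1)(p + B) = p (p + B + 1) + B brings out p + B + 1, which is 2^(a+1).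
      ≡⟨ expand p B ⟩
    2 * B * (p * (p + suc B)) + B * (2 * B)
      -- Reading 2B as q + 1 again lets the first product yield 2pq 2^a = 2n, and the second yield B
      -- and qB.
      ≡⟨ cong₂ (λ u v → u * (p * (p + suc B)) + B * v) 1+q≡2^[1+b] 1+q≡2^[1+b] ⟨
    suc q * (p * (p + suc B)) + B * suc q
      ≡⟨ cong (λ u → suc q * (p * u) + B * suc q) p+1+B≡2BC ⟩
    suc q * (p * (2 * (B * C))) + B * suc q
      ≡⟨ regroup p q B C ⟩
    2 * (p * q * (B * C)) + (B + p * C * (2 * B) + q * B)
      -- Once more 2B = q + 1: the remaining pC · 2B splits into pqC and pC, the other two removed
      -- divisors.
      ≡⟨ cong₂ (λ u v → 2 * (p * q * u) + (B + p * C * v + q * B)) 2^a≡2^b*2^k 1+q≡2^[1+b] ⟨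
    2 * n + (B + p * C * suc q + q * B)
      ≡⟨ cong (2 * n +_) (spread p q B C) ⟩
    2 * n + sum removed ∎
    where
    open ≡-Reasoning

    B C : ℕ
    B = 2 ^ b
    C = 2 ^ k

    p+1+B≡2BC : p + suc B ≡ 2 * (B * C)
    p+1+B≡2BC = trans p+1+2^b≡2^[1+a] (cong (2 *_) 2^a≡2^b*2^k)

    -- The sum is 2^(a+1) - 1, which the definition of p turns into p + 2^b.
    powers : sum (map (2 ^_) (upTo (suc a))) ≡ p + B
    powers = suc-injective (trans (suc-sum-powers-of-2 (suc a)) (trans (sym p+1+2^b≡2^[1+a]) (+-suc p B)))

    factor : ∀ p q B → (1 + (q + (p + (p * q + 0)))) * (p + B) ≡ (1 + q) * ((1 + p) * (p + B))
    factor = solve-∀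

    expand : ∀ p B → 2 * B * ((1 + p) * (p + B)) ≡ 2 * B * (p * (p + (1 + B))) + B * (2 * B)
    expand = solve-∀

    regroup : ∀ p q B C → (1 + q) * (p * (2 * (B * C))) + B * (1 + q)
            ≡ 2 * (p * q * (B * C)) + (B + p * C * (2 * B) + q * B)
    regroup = solve-∀

    -- The `1 * B` and the final `0` reproduce the unfolding of `sum removed`.
    spread : ∀ p q B C → B + p * C * (1 + q) + q * B ≡ 1 * B + (p * q * C + (p * C + (q * B + 0)))
    spread = solve-∀

  sum-chosen : sum chosen ≡ 2 * n
  sum-chosen = +-cancelʳ-≡ (sum removed) _ _ (begin
    sum chosen + sum removed  ≡⟨ sum-++ chosen removed ⟨
    sum (chosen ++ removed)   ≡⟨ sum-↭ (filter-∉-++-↭ candidates! removed! removed⊆candidates) ⟩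
    sum candidates            ≡⟨ sum-candidates ⟩
    2 * n + sum removed       ∎)
    where open ≡-Reasoning

  chosen-isRepresentation : IsRepresentation n chosen
  chosen-isRepresentation = record
    { positive  = >-nonZero⁻¹ n ⦃ n≢0 ⦄
    ; unique    = Unique.filter⁺ (_∉? removed) candidates!
    ; divide    = All.tabulate (candidates∣n ∘ proj₁ ∘ ∈-chosen⁻)
    -- Matching on `divides` reduces the quotient to `e`; the converse is the same closure with the
    -- two factors exchanged.
    ; symmetric = λ { {d} (divides e n≡e*d) → mk⇔
        (chosen-closed (sym n≡e*d))
        (chosen-closed (trans (*-comm d e) (sym n≡e*d))) }
    ; sum≡2n    = sum-chosen
    }

  -- The omitted divisors when p and q are prime.

  module _ (p-prime : Prime p) (q-prime : Prime q) where

    -- Strip p, then q, leaving a divisor of 2^a; the four branches correspond to the four values of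
    -- `Exponents`.
    ∣n⇒∈candidates : ∀ {d} → d ∣ n → d ∈ candidates
    ∣n⇒∈candidates {d} d∣n with ∣prime*⇒ p-prime (subst (d ∣_) (*-assoc p q (2 ^ a)) d∣n)
    ∣n⇒∈candidates d∣n | inj₁ d∣q2^a with ∣prime*⇒ q-prime d∣q2^a
    ... | inj₁ d∣2^a with i , i≤a , refl ← ∣2^⇒≡2^ a d∣2^a =
          subst (_∈ candidates) (*-identityˡ (2 ^ i)) (∈-candidates⁺ (false , false) i i≤a)
    ... | inj₂ (e , refl , e∣2^a) with i , i≤a , refl ← ∣2^⇒≡2^ a e∣2^a =
          ∈-candidates⁺ (false , true) i i≤a
    ∣n⇒∈candidates d∣n | inj₂ (e , refl , e∣q2^a) with ∣prime*⇒ q-prime e∣q2^a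
    ... | inj₁ e∣2^a with i , i≤a , refl ← ∣2^⇒≡2^ a e∣2^a =
          ∈-candidates⁺ (true , false) i i≤a
    ... | inj₂ (f , refl , f∣2^a) with i , i≤a , refl ← ∣2^⇒≡2^ a f∣2^a =
          subst (_∈ candidates) (*-assoc p q (2 ^ i)) (∈-candidates⁺ (true , true) i i≤a)

    -- Now every divisor of n is a candidate, and a candidate lies outside `chosen` exactly when it
    -- was removed.
    omitted↭removed : omitted n chosen ↭ removed
    omitted↭removed = Unique-⊆⊇⇒↭
      (Unique.filter⁺ (_∉? chosen) (Unique.filter⁺ (_∣? n) (Unique.upTo⁺ (suc n)))) removed!
      omitted⊆removed removed⊆omitted
      where
      omitted⊆removed : omitted n chosen ⊆ removed
      omitted⊆removed {d} d∈
        with d∈divisors , d∉chosen ← ∈-filter⁻ (_∉? chosen) {xs = divisors n} d∈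
        with d ∈? removed
      ... | yes d∈removed = d∈removed
      ... | no  d∉removed = contradiction
            (∈-chosen⁺ (∣n⇒∈candidates (proj₂ (∈-filter⁻ (_∣? n) {xs = upTo (suc n)} d∈divisors)))
              d∉removed)
            d∉chosen

      removed⊆omitted : removed ⊆ omitted n chosen
      removed⊆omitted d∈removed = ∈-filter⁺ (_∉? chosen)
        (∈-filter⁺ (_∣? n) (∈-upTo⁺ (s≤s (∣⇒≤ ⦃ n≢0 ⦄ d∣n))) d∣n)
        λ d∈chosen → proj₂ (∈-chosen⁻ d∈chosen) d∈removed
        where d∣n = candidates∣n (removed⊆candidates d∈removed)

theorem9 : (a b : ℕ) → a > b → b ≥ 1 →
    let q = 2 ^ (b + 1) ∸ 1
        p = 2 ^ (a + 1) ∸ (2 ^ b + 1)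
        n = p * q * 2 ^ a
    in StronglyPseudoperfect n ×
       (Prime p → Prime q → StronglyPseudoperfectOmitting 4 n)
theorem9 a b a>b b≥1 =
  (chosen , chosen-isRepresentation) ,
  -- `length removed` computes to 4.
  λ p-prime q-prime → chosen , chosen-isRepresentation , ↭-length (omitted↭removed p-prime q-prime)
  where
  2^[m+1]≡2*2^m : ∀ m → 2 ^ (m + 1) ≡ 2 * 2 ^ m
  2^[m+1]≡2*2^m m = cong (2 ^_) (+-comm m 1)

  2^b+1≤2^[a+1] : 2 ^ b + 1 ≤ 2 ^ (a + 1)
  2^b+1≤2^[a+1] = begin
    2 ^ b + 1          ≤⟨ +-mono-≤ (^-monoʳ-≤ 2 (<⇒≤ a>b)) (m^n>0 2 a) ⟩
    2 ^ a + 2 ^ a      ≡⟨ cong (2 ^ a +_) (+-identityʳ (2 ^ a)) ⟨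
    2 * 2 ^ a          ≡⟨ 2^[m+1]≡2*2^m a ⟨
    2 ^ (a + 1)        ∎
    where open ≤-Reasoning

  -- The additive equations hold because 1 ≤ 2^(b+1) and 2^b + 1 ≤ 2^(a+1), so neither `∸`
  -- truncates.
  open Family a b (a ∸ b) (2 ^ (a + 1) ∸ (2 ^ b + 1)) (2 ^ (b + 1) ∸ 1)
    (m+[n∸m]≡n (<⇒≤ a>b)) b≥1 (m<n⇒0<n∸m a>b)
    (trans (m+[n∸m]≡n (m^n>0 2 (b + 1))) (2^[m+1]≡2*2^m b))
    (trans (cong (2 ^ (a + 1) ∸ (2 ^ b + 1) +_) (+-comm 1 (2 ^ b)))
      (trans (m∸n+n≡m 2^b+1≤2^[a+1]) (2^[m+1]≡2*2^m a)))
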